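{- Let $G$ be a connected graph with no isolated vertices and with $\gamma(G)>1$. Then $$\gamma_t(G) \le \gamma(G) + \tfrac{1}{2}\gamma_c(G).$$ Moreover, this bound is tight: there exists such a graph attaining equality.
   Context: All graphs are finite, simple and undirected. A set $S\subseteq V(G)$ is a dominating set if every vertex not in $S$ is adjacent to some vertex of $S$; $\gamma(G)$ is the minimum size of a dominating set. A set $S$ is a total dominating set if every vertex of $G$ (including those in $S$) is adjacent to some vertex of $S$; $\gamma_t(G)$ is the minimum size of a total dominating set (it exists iff $G$ has no isolated vertices). A set $S$ is a connected dominating set if it is dominating and the subgraph induced by $S$ is connected; $\gamma_c(G)$ is the minimum size of a connected dominating set (it exists iff $G$ is connected). "Isolated-free" means having no isolated vertices. -}

module Defs where

open import Level using (0ℓ)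
open import Data.Nat using (ℕ; zero; suc; _≤_; z≤n; s≤s)
open import Data.Integer using (+_)
open import Data.Rational using (ℚ; _/_)
open import Data.Fin using (Fin)
import Data.Fin.Properties as Fin
open import Data.Fin.Subset using (Subset; _∈_; _∉_; ∣_∣; ⊤)
open import Data.Fin.Subset.Properties using (_∈?_; ∈⊤; anySubset?)
open import Data.List using (List; []; _∷_; allFin)
open import Data.List.Relation.Unary.Any using (here; there)
import Data.List.Membership.Propositional as List
open import Data.List.Membership.Propositional.Properties using (∈-allFin)
open import Data.Product using (∃; _×_; _,_; proj₁; proj₂)
open import Data.Sum using (_⊎_; inj₁; inj₂)
import Data.Nat.Properties as ℕ
open import Relation.Nullary using (yes; no; contradiction; map′; ¬?; _×-dec_; _⊎-dec_; _→-dec_)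
open import Relation.Unary using (Pred)
import Relation.Unary as U
open import Relation.Binary using (Rel; Decidable; Symmetric; Irreflexive)
open import Relation.Binary.PropositionalEquality using (_≡_; refl)
open import Relation.Binary.Construct.Closure.ReflexiveTransitive using (Star; ε; _◅_; _◅◅_; map)

record Graph (n : ℕ) : Set₁ where
  infix 4 _~_ _~?_
  field
    _~_    : Rel (Fin n) 0ℓ
    _~?_   : Decidable _~_
    sym    : Symmetric _~_
    irrefl : Irreflexive _≡_ _~_

module _ {n : ℕ} (G : Graph n) where
  open Graph G

  Connected : Set
  Connected = ∀ u v → Star _~_ u v

  IsolatedFree : Set
  IsolatedFree = ∀ v → ∃ λ u → u ~ v

  Dominating : Pred (Subset n) 0ℓ
  Dominating S = ∀ v → v ∉ S → ∃ λ u → u ∈ S × u ~ v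

  TotalDominating : Pred (Subset n) 0ℓ
  TotalDominating S = ∀ v → ∃ λ u → u ∈ S × u ~ v

  -- Adjacency in the subgraph induced by S.
  Induced : Subset n → Rel (Fin n) 0ℓ
  Induced S u v = u ∈ S × v ∈ S × u ~ v

  InducesConnected : Pred (Subset n) 0ℓ
  InducesConnected S = ∀ u v → u ∈ S → v ∈ S → Star (Induced S) u v

  -- The empty set induces a connected subgraph under this definition, but it
  -- dominates only the graph on no vertices.
  ConnectedDominating : Pred (Subset n) 0ℓ
  ConnectedDominating S = Dominating S × InducesConnected S

IsMinimumSize : ∀ {n} → Pred (Subset n) 0ℓ → ℕ → Set
IsMinimumSize P k = (∃ λ S → P S × ∣ S ∣ ≡ k) × (∀ S → P S → k ≤ ∣ S ∣)

least : {Q : Pred ℕ 0ℓ} → U.Decidable Q → ∀ m → Q m → ∃ λ k → Q k × (∀ j → Q j → k ≤ j)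
least Q? zero q = 0 , q , λ _ _ → z≤n
least {Q} Q? (suc m) q with Q? 0
... | yes q₀ = 0 , q₀ , λ _ _ → z≤n
... | no ¬q₀ with least (λ j → Q? (suc j)) m q
...   | k , qk , k≤ = suc k , qk , bound
  where
  bound : ∀ j → Q j → suc k ≤ j
  bound zero    q₀ = contradiction q₀ ¬q₀
  bound (suc j) qj = s≤s (k≤ j qj)

minimumSize : ∀ {n} {P : Pred (Subset n) 0ℓ} → U.Decidable P → ∃ P → ∃ (IsMinimumSize P)
minimumSize P? (S , p)
  with least (λ k → anySubset? (λ T → P? T ×-dec (∣ T ∣ ℕ.≟ k))) ∣ S ∣ (S , p , refl)
... | k , w , k≤ = k , w , λ T t → k≤ ∣ T ∣ (T , t , refl)

-- Warshall's algorithm: Via R xs u v says that v can be reached from u using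
-- only intermediate vertices in xs.
module _ {n : ℕ} {R : Rel (Fin n) 0ℓ} (R? : Decidable R) where

  Via : List (Fin n) → Rel (Fin n) 0ℓ
  Via []       u v = u ≡ v ⊎ R u v
  Via (x ∷ xs) u v = Via xs u v ⊎ (Via xs u x × Via xs x v)

  via? : ∀ xs → Decidable (Via xs)
  via? []       u v = (u Fin.≟ v) ⊎-dec R? u v
  via? (x ∷ xs) u v = via? xs u v ⊎-dec (via? xs u x ×-dec via? xs x v)

  via⇒star : ∀ xs {u v} → Via xs u v → Star R u v
  via⇒star []       (inj₁ refl)    = ε
  via⇒star []       (inj₂ r)       = r ◅ ε
  via⇒star (x ∷ xs) (inj₁ p)       = via⇒star xs p
  via⇒star (x ∷ xs) (inj₂ (p , q)) = via⇒star xs p ◅◅ via⇒star xs q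

  base⇒via : ∀ xs {u v} → u ≡ v ⊎ R u v → Via xs u v
  base⇒via []       b = b
  base⇒via (x ∷ xs) b = inj₁ (base⇒via xs b)

  via-trans : ∀ xs {u x v} → x List.∈ xs → Via xs u x → Via xs x v → Via xs u v
  via-trans (x ∷ xs) (here refl) p q = inj₂ (into p , outof q)
    where
    into : ∀ {u} → Via (x ∷ xs) u x → Via xs u x
    into (inj₁ p)       = p
    into (inj₂ (p , _)) = p
    outof : ∀ {v} → Via (x ∷ xs) x v → Via xs x v
    outof (inj₁ q)       = q
    outof (inj₂ (_ , q)) = q
  via-trans (y ∷ xs) (there i) (inj₁ p)       (inj₁ q)       = inj₁ (via-trans xs i p q)
  via-trans (y ∷ xs) (there i) (inj₁ p)       (inj₂ (q , r)) = inj₂ (via-trans xs i p q , r)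
  via-trans (y ∷ xs) (there i) (inj₂ (p , q)) (inj₁ r)       = inj₂ (p , via-trans xs i q r)
  via-trans (y ∷ xs) (there i) (inj₂ (p , _)) (inj₂ (_ , r)) = inj₂ (p , r)

  star⇒via : ∀ {u v} → Star R u v → Via (allFin n) u v
  star⇒via ε                   = base⇒via (allFin n) (inj₁ refl)
  star⇒via (_◅_ {j = w} r rs) =
    via-trans (allFin n) (∈-allFin w) (base⇒via (allFin n) (inj₂ r)) (star⇒via rs)

  star? : Decidable (Star R)
  star? u v = map′ (via⇒star (allFin n)) star⇒via (via? (allFin n) u v)

module _ {n : ℕ} (G : Graph n) where
  open Graph G

  dominating? : U.Decidable (Dominating G)
  dominating? S = Fin.all? λ v → ¬? (v ∈? S) →-dec Fin.any? λ u → (u ∈? S) ×-dec (u ~? v)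

  totalDominating? : U.Decidable (TotalDominating G)
  totalDominating? S = Fin.all? λ v → Fin.any? λ u → (u ∈? S) ×-dec (u ~? v)

  induced? : ∀ S → Decidable (Induced G S)
  induced? S u v = (u ∈? S) ×-dec ((v ∈? S) ×-dec (u ~? v))

  connectedDominating? : U.Decidable (ConnectedDominating G)
  connectedDominating? S = dominating? S ×-dec
    Fin.all? λ u → Fin.all? λ v → (u ∈? S) →-dec ((v ∈? S) →-dec star? (induced? S) u v)

  ⊤-dominating : Dominating G ⊤
  ⊤-dominating v v∉⊤ = contradiction ∈⊤ v∉⊤

  ⊤-totalDominating : IsolatedFree G → TotalDominating G ⊤
  ⊤-totalDominating iso v with iso v
  ... | u , u~v = u , ∈⊤ , u~v

  ⊤-connectedDominating : Connected G → ConnectedDominating G ⊤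
  ⊤-connectedDominating conn =
    ⊤-dominating , λ u v _ _ → map (λ u~v → ∈⊤ , ∈⊤ , u~v) (conn u v)

  γ-min : ∃ (IsMinimumSize (Dominating G))
  γ-min = minimumSize dominating? (⊤ , ⊤-dominating)

  γt-min : IsolatedFree G → ∃ (IsMinimumSize (TotalDominating G))
  γt-min iso = minimumSize totalDominating? (⊤ , ⊤-totalDominating iso)

  γc-min : Connected G → ∃ (IsMinimumSize (ConnectedDominating G))
  γc-min conn = minimumSize connectedDominating? (⊤ , ⊤-connectedDominating conn)

  -- The proof arguments of γt and γc only guarantee that a minimum exists; the
  -- values do not depend on them, since IsMinimumSize determines its number.
  γ : ℕ
  γ = proj₁ γ-min

  γt : IsolatedFree G → ℕ
  γt iso = proj₁ (γt-min iso)

  γc : Connected G → ℕ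
  γc conn = proj₁ (γc-min conn)

fromℕ : ℕ → ℚ
fromℕ k = + k / 1

{-# OPTIONS --safe #-}
-- Adding a neighbour of each vertex of a dominating set gives γt ≤ 2γ.  Since γc ≥ γ ≥ 2, a
-- minimum connected dominating set has at least two vertices, so each of them has a neighbour
-- inside the set, and γt ≤ γc.  The bound is the average of these two inequalities, and it is
-- attained by any graph with γt = 2γ = γc, such as the path on six vertices.
module Submission where

open import Defs
open import Data.Fin using (Fin; zero; suc; toℕ)
import Data.Fin.Properties as Fin
open import Data.Fin.Subset using (Subset; _∈_; ∣_∣; _∪_; ⊥; ⁅_⁆; inside; outside)
open import Data.Fin.Subset.Properties using (_∈?_; anySubset?; p⊆q⇒∣p∣≤∣q∣; ∣⁅x⁆∣≡1; ∣⊥∣≡0; x∈⁅x⁆; p⊆p∪q; q⊆p∪q)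
import Data.Integer as ℤ
import Data.Integer.Properties as ℤ
open import Data.Nat using (ℕ; _<_; suc; s≤s; z≤n)
import Data.Nat as ℕ
import Data.Nat.Properties as ℕ
open import Data.Rational using (½; _+_; _*_; _≤_; toℚᵘ)
open import Data.Rational.Properties using (toℚᵘ-cancel-≤; toℚᵘ-fromℚᵘ; toℚᵘ-homo-+; toℚᵘ-homo-*)
open import Data.Rational.Unnormalised using (ℚᵘ; mkℚᵘ; *≤*)
import Data.Rational.Unnormalised as ℚᵘ
import Data.Rational.Unnormalised.Properties as ℚᵘ
open import Data.Product using (Σ; _×_; _,_; proj₁; proj₂)
open import Data.Sum using (_⊎_; inj₁; inj₂; swap)
open import Data.Vec using ([]; _∷_; here; there)
open import Function using (_∘_)
open import Relation.Binary.Construct.Closure.ReflexiveTransitive using (Star; ε; _◅_)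
open import Relation.Binary.PropositionalEquality using (_≡_; refl; sym; cong; cong₂; subst)
open import Relation.Nullary using (yes; no; contradiction; _×-dec_; _⊎-dec_)
open import Relation.Nullary.Decidable using (toWitness; toWitnessFalse)

∣p∪q∣≤∣p∣+∣q∣ : ∀ {n} (p q : Subset n) → ∣ p ∪ q ∣ ℕ.≤ ∣ p ∣ ℕ.+ ∣ q ∣
∣p∪q∣≤∣p∣+∣q∣ []            []            = z≤n
∣p∪q∣≤∣p∣+∣q∣ (outside ∷ p) (outside ∷ q) = ∣p∪q∣≤∣p∣+∣q∣ p q
∣p∪q∣≤∣p∣+∣q∣ (outside ∷ p) (inside ∷ q)
  rewrite ℕ.+-suc ∣ p ∣ ∣ q ∣ = s≤s (∣p∪q∣≤∣p∣+∣q∣ p q)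
∣p∪q∣≤∣p∣+∣q∣ (inside ∷ p)  (outside ∷ q) = s≤s (∣p∪q∣≤∣p∣+∣q∣ p q)
∣p∪q∣≤∣p∣+∣q∣ (inside ∷ p)  (inside ∷ q)
  rewrite ℕ.+-suc ∣ p ∣ ∣ q ∣ = s≤s (ℕ.m≤n⇒m≤1+n (∣p∪q∣≤∣p∣+∣q∣ p q))

-- The direct image of a subset. `f` may merge points, so its size is bounded by that of `p` but
-- need not equal it.
image : ∀ {m n} → (Fin m → Fin n) → Subset m → Subset n
image f []            = ⊥
image f (outside ∷ p) = image (f ∘ suc) p
image f (inside ∷ p)  = ⁅ f zero ⁆ ∪ image (f ∘ suc) p

∈-image : ∀ {m n} (f : Fin m → Fin n) (p : Subset m) {x} → x ∈ p → f x ∈ image f p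
∈-image f (inside ∷ p)  here        = p⊆p∪q _ (x∈⁅x⁆ (f zero))
∈-image f (inside ∷ p)  (there x∈p) = q⊆p∪q ⁅ f zero ⁆ _ (∈-image (f ∘ suc) p x∈p)
∈-image f (outside ∷ p) (there x∈p) = ∈-image (f ∘ suc) p x∈p

∣image∣≤ : ∀ {m n} (f : Fin m → Fin n) (p : Subset m) → ∣ image f p ∣ ℕ.≤ ∣ p ∣
∣image∣≤ {n = n} f []    = ℕ.≤-reflexive (∣⊥∣≡0 n)
∣image∣≤ f (outside ∷ p) = ∣image∣≤ (f ∘ suc) p
∣image∣≤ f (inside ∷ p)  = begin
  ∣ ⁅ f zero ⁆ ∪ image (f ∘ suc) p ∣           ≤⟨ ∣p∪q∣≤∣p∣+∣q∣ ⁅ f zero ⁆ _ ⟩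
  ∣ ⁅ f zero ⁆ ∣ ℕ.+ ∣ image (f ∘ suc) p ∣     ≡⟨ cong (ℕ._+ ∣ image (f ∘ suc) p ∣) (∣⁅x⁆∣≡1 (f zero)) ⟩
  suc ∣ image (f ∘ suc) p ∣                    ≤⟨ s≤s (∣image∣≤ (f ∘ suc) p) ⟩
  suc ∣ p ∣                                    ∎
  where open ℕ.≤-Reasoning

module _ {n : ℕ} (G : Graph n) where
  open Graph G using (_~_; _~?_) renaming (sym to ~-sym)

  γ≤ : ∀ S → Dominating G S → γ G ℕ.≤ ∣ S ∣
  γ≤ = proj₂ (proj₂ (γ-min G))

  γt≤ : ∀ iso S → TotalDominating G S → γt G iso ℕ.≤ ∣ S ∣
  γt≤ iso = proj₂ (proj₂ (γt-min G iso))

  γc≤ : ∀ conn S → ConnectedDominating G S → γc G conn ℕ.≤ ∣ S ∣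
  γc≤ conn = proj₂ (proj₂ (γc-min G conn))

  addNeighbours : IsolatedFree G → Subset n → Subset n
  addNeighbours iso S = S ∪ image (proj₁ ∘ iso) S

  -- A vertex of `S` is adjacent to the neighbour added on its behalf; a vertex outside `S` already
  -- has a neighbour in `S`.
  addNeighbours-totalDominating : ∀ iso {S} → Dominating G S → TotalDominating G (addNeighbours iso S)
  addNeighbours-totalDominating iso {S} dom v with v ∈? S
  ... | yes v∈S = proj₁ (iso v) , q⊆p∪q S _ (∈-image (proj₁ ∘ iso) S v∈S) , proj₂ (iso v)
  ... | no  v∉S with u , u∈S , u~v ← dom v v∉S = u , p⊆p∪q _ u∈S , u~v

  γt≤γ+γ : ∀ iso → γt G iso ℕ.≤ γ G ℕ.+ γ G
  γt≤γ+γ iso with D , dom , ∣D∣≡γ ← proj₁ (proj₂ (γ-min G)) = begin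
    γt G iso                                ≤⟨ γt≤ iso _ (addNeighbours-totalDominating iso dom) ⟩
    ∣ addNeighbours iso D ∣                 ≤⟨ ∣p∪q∣≤∣p∣+∣q∣ D _ ⟩
    ∣ D ∣ ℕ.+ ∣ image (proj₁ ∘ iso) D ∣     ≤⟨ ℕ.+-monoʳ-≤ ∣ D ∣ (∣image∣≤ (proj₁ ∘ iso) D) ⟩
    ∣ D ∣ ℕ.+ ∣ D ∣                         ≡⟨ cong₂ ℕ._+_ ∣D∣≡γ ∣D∣≡γ ⟩
    γ G ℕ.+ γ G                             ∎
    where open ℕ.≤-Reasoning

  -- Only vertices of `S` need an argument. One with no neighbour in `S` reaches nothing but itself
  -- in the induced subgraph, so connectedness would make `S` a singleton.
  connectedDominating⇒totalDominating : ∀ {S} → ConnectedDominating G S → 1 < ∣ S ∣ → TotalDominating G S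
  connectedDominating⇒totalDominating {S} (dom , conn) 1<∣S∣ v with v ∈? S
  ... | no  v∉S = dom v v∉S
  ... | yes v∈S with Fin.any? (λ u → (u ∈? S) ×-dec (u ~? v))
  ...   | yes found = found
  ...   | no  none  = contradiction ∣S∣≤1 (ℕ.<⇒≱ 1<∣S∣)
    where
    trivial : ∀ {w} → Star (Induced G S) v w → w ∈ ⁅ v ⁆
    trivial ε                       = x∈⁅x⁆ v
    -- The first edge of a nonempty walk from `v` already exhibits a neighbour of `v` in `S`.
    trivial ((_ , u∈S , v~u) ◅ _) = contradiction (_ , u∈S , ~-sym v~u) none
    ∣S∣≤1 : ∣ S ∣ ℕ.≤ 1
    ∣S∣≤1 = subst (∣ S ∣ ℕ.≤_) (∣⁅x⁆∣≡1 v) (p⊆q⇒∣p∣≤∣q∣ λ {w} w∈S → trivial (conn v w v∈S w∈S))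

  γt≤γc : ∀ conn iso → 1 < γ G → γt G iso ℕ.≤ γc G conn
  γt≤γc conn iso 1<γ with C , cd , ∣C∣≡γc ← proj₁ (proj₂ (γc-min G conn)) =
    subst (γt G iso ℕ.≤_) ∣C∣≡γc
      -- `C` is in particular dominating, whence 1 < γ ≤ ∣ C ∣.
      (γt≤ iso C (connectedDominating⇒totalDominating cd (ℕ.≤-trans 1<γ (γ≤ C (proj₁ cd)))))

-- Half the sum of the two hypotheses. The comparison is made in `ℚᵘ`, where sums and products are
-- not reduced to lowest terms and so unfold to explicit numerators and denominators.
fromℕ-mean : ∀ t g c → t ℕ.≤ g ℕ.+ g → t ℕ.≤ c → fromℕ t ≤ fromℕ g + ½ * fromℕ c
fromℕ-mean t g c t≤g+g t≤c = toℚᵘ-cancel-≤ (begin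
  toℚᵘ (fromℕ t)                                  ≃⟨ toℚᵘ-fromℚᵘ (ι t) ⟩
  ι t                                             ≤⟨ *≤* scaled ⟩
  ι g ℚᵘ.+ ℚᵘ.½ ℚᵘ.* ι c                          ≃⟨ ℚᵘ.+-cong (toℚᵘ-fromℚᵘ (ι g)) (ℚᵘ.*-congˡ {ℚᵘ.½} (toℚᵘ-fromℚᵘ (ι c))) ⟨
  toℚᵘ (fromℕ g) ℚᵘ.+ ℚᵘ.½ ℚᵘ.* toℚᵘ (fromℕ c)    ≃⟨ ℚᵘ.+-congʳ (toℚᵘ (fromℕ g)) (toℚᵘ-homo-* ½ (fromℕ c)) ⟨
  toℚᵘ (fromℕ g) ℚᵘ.+ toℚᵘ (½ * fromℕ c)          ≃⟨ toℚᵘ-homo-+ (fromℕ g) (½ * fromℕ c) ⟨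
  toℚᵘ (fromℕ g + ½ * fromℕ c)                    ∎)
  where
  open ℚᵘ.≤-Reasoning
  ι : ℕ → ℚᵘ
  ι k = mkℚᵘ (ℤ.+ k) 0
  doubled : t ℕ.* 2 ℕ.≤ g ℕ.* 2 ℕ.+ c
  doubled rewrite ℕ.*-comm t 2 | ℕ.*-comm g 2 | ℕ.+-identityʳ t | ℕ.+-identityʳ g = ℕ.+-mono-≤ t≤g+g t≤c
  -- The cross-multiplied inequality exactly as `*≤*` unfolds it: the denominators are 1 on the left
  -- and 2 on the right.
  scaled : ℤ.+ t ℤ.* ℤ.+ 2 ℤ.≤ (ℤ.+ g ℤ.* ℤ.+ 2 ℤ.+ (ℤ.+ 1 ℤ.* ℤ.+ c) ℤ.* ℤ.+ 1) ℤ.* ℤ.+ 1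
  scaled rewrite ℤ.*-identityʳ (ℤ.+ g ℤ.* ℤ.+ 2 ℤ.+ (ℤ.+ 1 ℤ.* ℤ.+ c) ℤ.* ℤ.+ 1)
               | ℤ.*-identityʳ (ℤ.+ 1 ℤ.* ℤ.+ c) | ℤ.*-identityˡ (ℤ.+ c)
               | sym (ℤ.pos-* t 2) | sym (ℤ.pos-* g 2) = ℤ.+≤+ doubled

path : ∀ n → Graph n
path n = record
  { _~_    = λ u v → suc (toℕ u) ≡ toℕ v ⊎ suc (toℕ v) ≡ toℕ u
  ; _~?_   = λ u v → (suc (toℕ u) ℕ.≟ toℕ v) ⊎-dec (suc (toℕ v) ℕ.≟ toℕ u)
  ; sym    = swap
  ; irrefl = λ { refl (inj₁ e) → ℕ.1+n≢n e ; refl (inj₂ e) → ℕ.1+n≢n e }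
  }

P₆ : Graph 6
P₆ = path 6

P₆-connected : Connected P₆
P₆-connected = toWitness {a? = Fin.all? λ u → Fin.all? λ v → star? (Graph._~?_ P₆) u v} _

P₆-isolatedFree : IsolatedFree P₆
P₆-isolatedFree = toWitness {a? = Fin.all? λ v → Fin.any? λ u → Graph._~?_ P₆ u v} _

leafNeighbours innerVertices : Subset 6
leafNeighbours = outside ∷ inside ∷ outside ∷ outside ∷ inside ∷ outside ∷ []
innerVertices  = outside ∷ inside ∷ inside  ∷ inside  ∷ inside ∷ outside ∷ []

γ-P₆≤2 : γ P₆ ℕ.≤ 2
γ-P₆≤2 = γ≤ P₆ leafNeighbours (toWitness {a? = dominating? P₆ leafNeighbours} _)

γc-P₆≤4 : γc P₆ P₆-connected ℕ.≤ 4
γc-P₆≤4 = γc≤ P₆ P₆-connected innerVertices (toWitness {a? = connectedDominating? P₆ innerVertices} _)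

4≤γt-P₆ : 4 ℕ.≤ γt P₆ P₆-isolatedFree
4≤γt-P₆ with S , td , ∣S∣≡γt ← proj₁ (proj₂ (γt-min P₆ P₆-isolatedFree)) =
  subst (4 ℕ.≤_) ∣S∣≡γt (ℕ.≮⇒≥ λ ∣S∣<4 → noSmall (S , td , ∣S∣<4))
  where
  -- Exhaustive search: the decision procedure runs through all 64 subsets of the vertices.
  noSmall = toWitnessFalse {a? = anySubset? λ S → totalDominating? P₆ S ×-dec (∣ S ∣ ℕ.<? 4)} _

-- If γ ≤ 1, then γt ≤ 2γ ≤ 2, against 4 ≤ γt; no second search is needed.
1<γ-P₆ : 1 < γ P₆
1<γ-P₆ = ℕ.≰⇒> λ γ≤1 →
  contradiction (ℕ.≤-trans 4≤γt-P₆ (ℕ.≤-trans (γt≤γ+γ P₆ P₆-isolatedFree) (ℕ.+-mono-≤ γ≤1 γ≤1)))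
    (λ { (s≤s (s≤s ())) })

-- The chain 4 ≤ γt ≤ γc ≤ 4 fixes both γt and γc, and 1 < γ ≤ 2 fixes γ.
P₆-tight : fromℕ (γt P₆ P₆-isolatedFree) ≡ fromℕ (γ P₆) + ½ * fromℕ (γc P₆ P₆-connected)
P₆-tight = values γt≡4 (ℕ.≤-antisym γ-P₆≤2 1<γ-P₆) (ℕ.≤-antisym γc-P₆≤4 (ℕ.≤-trans 4≤γt-P₆ γt≤γc′))
  where
  γt≤γc′ : γt P₆ P₆-isolatedFree ℕ.≤ γc P₆ P₆-connected
  γt≤γc′ = γt≤γc P₆ P₆-connected P₆-isolatedFree 1<γ-P₆
  γt≡4 : γt P₆ P₆-isolatedFree ≡ 4
  γt≡4 = ℕ.≤-antisym (ℕ.≤-trans γt≤γc′ γc-P₆≤4) 4≤γt-P₆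
  -- Generalising to variables lets the three equations be matched, leaving the closed identity 4 =
  -- 2 + ½ · 4 for `refl`.
  values : ∀ {t g c} → t ≡ 4 → g ≡ 2 → c ≡ 4 → fromℕ t ≡ fromℕ g + ½ * fromℕ c
  values refl refl refl = refl

theorem2p1 : (∀ {n : ℕ} (G : Graph n) (conn : Connected G) (iso : IsolatedFree G) → 1 < γ G →
    fromℕ (γt G iso) ≤ fromℕ (γ G) + ½ * fromℕ (γc G conn))
    ×
    (Σ ℕ λ n → Σ (Graph n) λ G → Σ (Connected G) λ conn → Σ (IsolatedFree G) λ iso →
    1 < γ G × fromℕ (γt G iso) ≡ fromℕ (γ G) + ½ * fromℕ (γc G conn))
theorem2p1 =
  (λ G conn iso 1<γ → fromℕ-mean (γt G iso) (γ G) (γc G conn) (γt≤γ+γ G iso) (γt≤γc G conn iso 1<γ)) ,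
  6 , P₆ , P₆-connected , P₆-isolatedFree , 1<γ-P₆ , P₆-tight
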